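{- Let $\mathcal I,\mathcal J$ be ideals on $\omega$ and let $\mathcal F,\mathcal G\subseteq\omega^\omega$. If $\mathcal G$ contains the identity function, then $\mathfrak u(\mathcal I,\mathcal F,\mathcal J,\mathcal G)>|\mathcal F|$ if and only if there exists an ultrafilter $\mathcal U$ on $\omega$ such that $\mathcal I\not\le_{\mathcal F}\mathcal U^*$ and $\mathcal J\le_{\mathcal G}\mathcal U^*$.
   Context: An ideal on $\omega$ is a family of subsets of $\omega$ closed under finite unions and subsets, containing all finite sets and not containing $\omega$. Ultrafilters on $\omega$ contain all cofinite sets; $\mathcal U^*=\{\omega\setminus A:A\in\mathcal U\}$ is the dual ideal. For $\mathcal F\subseteq\omega^\omega$ and ideals $\mathcal I,\mathcal K$ on $\omega$, $\mathcal I\le_{\mathcal F}\mathcal K$ means that there is $f\in\mathcal F$ with $f^{ -1}[B]\in\mathcal K$ for every $B\in\mathcal I$. For an ideal $\mathcal K$ on $\omega$ and $\mathcal A\subseteq\mathcal P(\omega)$ let $\mathcal K(\mathcal A)=\{B\subseteq\omega:\exists F\in[\mathcal A]^{<\omega}\ (B\setminus\bigcup F\in\mathcal K)\}$; it is an ideal exactly when $\omega\notin\mathcal K(\mathcal A)$. For a cardinal $\lambda\le\mathfrak c=2^{\aleph_0}$, $\mathcal I\preceq^\lambda_{\mathcal F,\mathcal G}\mathcal J$ means: for each ideal $\mathcal J'$ on $\omega$ with $\mathcal J\le_{\mathcal G}\mathcal J'$ there exists $\mathcal A\subseteq\mathcal P(\omega)$ with $|\mathcal A|<\lambda$ such that $\omega\notin\mathcal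 J'(\mathcal A)$ and $\mathcal I\le_{\mathcal F}\mathcal J'(\mathcal A)$. Finally $$\mathfrak u(\mathcal I,\mathcal F,\mathcal J,\mathcal G)=\min\left(\{\lambda\le\mathfrak c:\mathcal I\preceq^\lambda_{\mathcal F,\mathcal G}\mathcal J\}\cup\{\mathfrak c^+\}\right).$$ -}

module Defs where

open import Axiom.ExcludedMiddle using (ExcludedMiddle)
open import Axiom.Extensionality.Propositional using (Extensionality)
open import Data.Bool using (Bool; true; false; T; not; _∧_; _∨_)
open import Data.Empty using (⊥-elim)
open import Data.List using (List; foldr)
open import Data.List.Membership.Propositional using () renaming (_∈_ to _∈ₗ_)
open import Data.List.Relation.Unary.All using (All)
open import Data.Nat using (ℕ)
open import Data.Product using (∃; ∃-syntax; Σ-syntax; _×_; _,_; proj₁; proj₂)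
open import Data.Refinement using (Refinement)
open import Data.Sum using (_⊎_; inj₁; inj₂; [_,_]′)
open import Data.Unit using (tt)
open import Function using (_∘_; id; _↣_; mk↣)
open import Level using (Level; _⊔_; 0ℓ) renaming (suc to lsuc)
open import Relation.Binary.PropositionalEquality
  using (_≡_; _≢_; refl; sym; trans; cong; cong-app; subst)
open import Relation.Nullary using (¬_; yes; no)
open import Relation.Nullary.Decidable using (⌊_⌋; toWitness; fromWitness)
open import Relation.Unary using (Pred; _∈_; ｛_｝; _∪_; Satisfiable)

private
  variable
    a ℓ : Level
    X : Set a

-- Subsets are characteristic functions.  In the presence of excluded
-- middle this is no restriction, and it keeps 𝒫 X in the universe of X;
-- in particular 𝒫 ℕ is a set of size 2^ℵ₀.

𝒫 : Set a → Set a
𝒫 X = X → Bool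

infix 4 _∈ᵇ_ _⊆ᵇ_
infixl 6 _∪ᵇ_ _∖ᵇ_

_∈ᵇ_ : X → 𝒫 X → Set
x ∈ᵇ A = T (A x)

_⊆ᵇ_ : {X : Set a} → 𝒫 X → 𝒫 X → Set a
A ⊆ᵇ B = ∀ x → x ∈ᵇ A → x ∈ᵇ B

∅ᵇ : 𝒫 X
∅ᵇ _ = false

full : 𝒫 X
full _ = true

∁ᵇ : 𝒫 X → 𝒫 X
∁ᵇ A x = not (A x)

_∪ᵇ_ : 𝒫 X → 𝒫 X → 𝒫 X
(A ∪ᵇ B) x = A x ∨ B x

_∩ᵇ_ : 𝒫 X → 𝒫 X → 𝒫 X
(A ∩ᵇ B) x = A x ∧ B x

_∖ᵇ_ : 𝒫 X → 𝒫 X → 𝒫 X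
A ∖ᵇ B = A ∩ᵇ ∁ᵇ B

⋃ᵇ : List (𝒫 X) → 𝒫 X
⋃ᵇ = foldr _∪ᵇ_ ∅ᵇ

Finite : 𝒫 ℕ → Set
Finite A = ∃[ xs ] (∀ n → n ∈ᵇ A → n ∈ₗ xs)

Family : Set₁
Family = Pred (𝒫 ℕ) 0ℓ

record IsIdeal (I : Family) : Set where
  field
    ⊆-closed : ∀ {A B} → A ⊆ᵇ B → B ∈ I → A ∈ I
    ∪-closed : ∀ {A B} → A ∈ I → B ∈ I → (A ∪ᵇ B) ∈ I
    finite   : ∀ {A} → Finite A → A ∈ I
    proper   : ¬ (full ∈ I)

record IsUltrafilter (U : Family) : Set where
  field
    ⊆-closed : ∀ {A B} → A ⊆ᵇ B → A ∈ U → B ∈ U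
    ∩-closed : ∀ {A B} → A ∈ U → B ∈ U → (A ∩ᵇ B) ∈ U
    cofinite : ∀ {A} → Finite (∁ᵇ A) → A ∈ U
    proper   : ¬ (∅ᵇ ∈ U)
    ultra    : ∀ A → A ∈ U ⊎ ∁ᵇ A ∈ U

_* : Family → Family
(U *) B = ∃[ A ] A ∈ U × B ≡ ∁ᵇ A

infix 4 _≤[_]_

_≤[_]_ : Family → Pred (ℕ → ℕ) 0ℓ → Family → Set
I ≤[ F ] K = ∃[ f ] f ∈ F × (∀ B → B ∈ I → (B ∘ f) ∈ K)

-- A finite subset of A is presented by a list of members of A.

_⟨_⟩ : Family → Family → Family
(K ⟨ A ⟩) B = ∃[ Bs ] All A Bs × (B ∖ᵇ ⋃ᵇ Bs) ∈ K

-- A cardinal is represented by any set of that size, and cardinals are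
-- compared by injections.  The membership proof in a Refinement is
-- irrelevant, so the elements of ∣ A ∣ are exactly the elements of A, each
-- counted once.

∣_∣ : Pred X ℓ → Set _
∣_∣ {X = X} A = Refinement X A

infix 4 _≼_ _≺_

_≼_ : Set → Set → Set
κ ≼ μ = κ ↣ μ

_≺_ : Set → Set → Set
κ ≺ μ = κ ≼ μ × ¬ (μ ≼ κ)

𝔠 : Set
𝔠 = 𝒫 ℕ

infix 4 _⪯[_∣_,_]_

_⪯[_∣_,_]_ : Family → Set → Pred (ℕ → ℕ) 0ℓ → Pred (ℕ → ℕ) 0ℓ → Family → Set₁
I ⪯[ κ ∣ F , G ] J =
  ∀ J′ → IsIdeal J′ → J ≤[ G ] J′ →
  Σ[ A ∈ Family ] ∣ A ∣ ≺ κ × ¬ (full ∈ J′ ⟨ A ⟩) × I ≤[ F ] J′ ⟨ A ⟩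

record IsLeast (S : Pred Set ℓ) (κ : Set) : Set (lsuc 0ℓ ⊔ ℓ) where
  field
    member : κ ∈ S
    lower  : ∀ μ → μ ∈ S → κ ≼ μ

-- Excluded middle is assumed for all types, not only for propositions, so
-- em also decides whether a type has an element and provides one; together
-- with function extensionality it yields the axiom of choice.

module Classical
  (em : ∀ {ℓ} → ExcludedMiddle ℓ)
  (fe : ∀ {a b} → Extensionality a b)
  where

  private
    byContra : {P : Set ℓ} → ¬ ¬ P → P
    byContra {P = P} ¬¬p with em {P = P}
    ... | yes p = p
    ... | no ¬p = ⊥-elim (¬¬p ¬p)

    ¬∀⇒∃¬ : {P : X → Set ℓ} → ¬ (∀ x → P x) → ∃[ x ] ¬ P x
    ¬∀⇒∃¬ ¬∀ = byContra λ ¬∃ → ¬∀ λ x → byContra λ ¬p → ¬∃ (x , ¬p)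

    ⟦_⟧ : Pred X ℓ → 𝒫 X
    ⟦ P ⟧ x = ⌊ em {P = P x} ⌋

    ⟦⟧⁻ : (P : Pred X ℓ) → ∀ {x} → x ∈ᵇ ⟦ P ⟧ → P x
    ⟦⟧⁻ P = toWitness

    ⟦⟧⁺ : (P : Pred X ℓ) → ∀ {x} → P x → x ∈ᵇ ⟦ P ⟧
    ⟦⟧⁺ P = fromWitness

    T-antisym : ∀ b c → (T b → T c) → (T c → T b) → b ≡ c
    T-antisym false false _ _ = refl
    T-antisym false true  _ g = ⊥-elim (g tt)
    T-antisym true  false f _ = ⊥-elim (f tt)
    T-antisym true  true  _ _ = refl

    ⊆ᵇ-antisym : {A B : 𝒫 X} → A ⊆ᵇ B → B ⊆ᵇ A → A ≡ B
    ⊆ᵇ-antisym {A = A} {B} A⊆B B⊆A = fe λ x → T-antisym (A x) (B x) (A⊆B x) (B⊆A x)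

  -- Every symmetric relation has a maximal clique.  The tower of subsets
  -- generated from ∅ by adding one chosen point at a time and by unions is
  -- a chain, and its union is a maximal clique.

  module MaximalClique
    {P : Set a} (_~_ : P → P → Set ℓ) (~-sym : ∀ {x y} → x ~ y → y ~ x)
    where

    Clique : 𝒫 P → Set _
    Clique A = ∀ x y → x ∈ᵇ A → y ∈ᵇ A → x ≢ y → x ~ y

    Extends : 𝒫 P → P → Set _
    Extends A p = ∀ x → x ∈ᵇ A → p ~ x

    private
      Fresh : 𝒫 P → P → Set _
      Fresh A p = ¬ (p ∈ᵇ A) × Extends A p

      next : 𝒫 P → 𝒫 P
      next A with em {P = ∃ (Fresh A)}
      ... | yes (p , _) = ⟦ (λ x → x ∈ᵇ A ⊎ x ≡ p) ⟧
      ... | no  _       = A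

      next-⊇ : ∀ A → A ⊆ᵇ next A
      next-⊇ A x x∈A with em {P = ∃ (Fresh A)}
      ... | yes (p , _) = ⟦⟧⁺ (λ x → x ∈ᵇ A ⊎ x ≡ p) (inj₁ x∈A)
      ... | no  _       = x∈A

      next-clique : ∀ A → Clique A → Clique (next A)
      next-clique A cl x y x∈ y∈ x≢y with em {P = ∃ (Fresh A)}
      ... | no _ = cl x y x∈ y∈ x≢y
      ... | yes (p , _ , ext)
        with ⟦⟧⁻ (λ x → x ∈ᵇ A ⊎ x ≡ p) x∈ | ⟦⟧⁻ (λ x → x ∈ᵇ A ⊎ x ≡ p) y∈
      ...   | inj₁ x∈A  | inj₁ y∈A  = cl x y x∈A y∈A x≢y
      ...   | inj₁ x∈A  | inj₂ refl = ~-sym (ext x x∈A)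
      ...   | inj₂ refl | inj₁ y∈A  = ext y y∈A
      ...   | inj₂ refl | inj₂ refl = ⊥-elim (x≢y refl)

      next-fixed : ∀ A → next A ⊆ᵇ A → ¬ ∃ (Fresh A)
      next-fixed A ⊆A fresh with em {P = ∃ (Fresh A)}
      ... | no ¬fresh = ¬fresh fresh
      ... | yes (p , p∉A , _) = p∉A (⊆A p (⟦⟧⁺ (λ x → x ∈ᵇ A ⊎ x ≡ p) (inj₂ refl)))

      between : ∀ A B → A ⊆ᵇ B → B ⊆ᵇ next A → B ⊆ᵇ A ⊎ next A ⊆ᵇ B
      between A B A⊆B B⊆ with em {P = ∃ (Fresh A)}
      ... | no _ = inj₁ B⊆
      ... | yes (p , _) with em {P = p ∈ᵇ B}
      ...   | yes p∈B = inj₂ λ x x∈ →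
                [ A⊆B x , (λ { refl → p∈B }) ]′ (⟦⟧⁻ (λ x → x ∈ᵇ A ⊎ x ≡ p) x∈)
      ...   | no  p∉B = inj₁ λ x x∈B →
                [ id , (λ { refl → ⊥-elim (p∉B x∈B) }) ]′
                  (⟦⟧⁻ (λ x → x ∈ᵇ A ⊎ x ≡ p) (B⊆ x x∈B))

      ⋃ : Pred (𝒫 P) 0ℓ → 𝒫 P
      ⋃ C = ⟦ (λ x → ∃[ A ] A ∈ C × x ∈ᵇ A) ⟧

      ⋃-upper : ∀ C {A} → A ∈ C → A ⊆ᵇ ⋃ C
      ⋃-upper C {A} A∈C x x∈A = ⟦⟧⁺ (λ x → ∃[ A ] A ∈ C × x ∈ᵇ A) (A , A∈C , x∈A)

      ⋃⁻ : ∀ C {x} → x ∈ᵇ ⋃ C → ∃[ A ] A ∈ C × x ∈ᵇ A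
      ⋃⁻ C = ⟦⟧⁻ (λ x → ∃[ A ] A ∈ C × x ∈ᵇ A)

      data Tower : 𝒫 P → Set (a ⊔ lsuc 0ℓ) where
        step : ∀ {A} → Tower A → Tower (next A)
        sup  : ∀ C → (∀ {A} → A ∈ C → Tower A) → Tower (⋃ C)

      ⋃-split : ∀ C A B → (∀ {Z} → Z ∈ C → Z ⊆ᵇ A ⊎ B ⊆ᵇ Z) →
                ⋃ C ⊆ᵇ A ⊎ B ⊆ᵇ ⋃ C
      ⋃-split C A B h with em {P = ∃[ Z ] Z ∈ C × B ⊆ᵇ Z}
      ... | yes (Z , Z∈C , B⊆Z) = inj₂ λ x x∈B → ⋃-upper C Z∈C x (B⊆Z x x∈B)
      ... | no ¬Z = inj₁ λ x x∈⋃ → let (Z , Z∈C , x∈Z) = ⋃⁻ C x∈⋃ in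
        [ (λ Z⊆A → Z⊆A x x∈Z) , (λ B⊆Z → ⊥-elim (¬Z (Z , Z∈C , B⊆Z))) ]′ (h Z∈C)

      Comparable : 𝒫 P → Set _
      Comparable A = ∀ {B} → Tower B → B ⊆ᵇ A ⊎ A ⊆ᵇ B

      jump : ∀ {A} → Comparable A → ∀ {B} → Tower B → B ⊆ᵇ A ⊎ next A ⊆ᵇ B
      jump {A} cmp (step {B} t) with jump cmp t
      ... | inj₂ ⊆B = inj₂ λ x x∈ → next-⊇ B x (⊆B x x∈)
      ... | inj₁ B⊆A with cmp (step t)
      ...   | inj₁ nB⊆A = inj₁ nB⊆A
      ...   | inj₂ A⊆nB with between B A B⊆A A⊆nB
      ...     | inj₂ nB⊆A = inj₁ nB⊆A
      ...     | inj₁ A⊆B with ⊆ᵇ-antisym A⊆B B⊆A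
      ...       | refl = inj₂ λ _ → id
      jump {A} cmp (sup C h) = ⋃-split C A (next A) λ Z∈C → jump cmp (h Z∈C)

      comparable : ∀ {A} → Tower A → Comparable A
      comparable (step {A} t) t′ with jump (comparable t) t′
      ... | inj₁ B⊆A = inj₁ λ x x∈B → next-⊇ A x (B⊆A x x∈B)
      ... | inj₂ nA⊆B = inj₂ nA⊆B
      comparable (sup C h) {B} t′
        with ⋃-split C B B (λ Z∈C → [ inj₂ , inj₁ ]′ (comparable (h Z∈C) t′))
      ... | inj₁ ⋃⊆B = inj₂ ⋃⊆B
      ... | inj₂ B⊆⋃ = inj₁ B⊆⋃

      tower-clique : ∀ {A} → Tower A → Clique A
      tower-clique (step {A} t) = next-clique A (tower-clique t)
      tower-clique (sup C h) x y x∈ y∈ x≢y =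
        let (A , A∈C , x∈A) = ⋃⁻ C x∈
            (B , B∈C , y∈B) = ⋃⁻ C y∈
        in [ (λ B⊆A → tower-clique (h A∈C) x y x∈A (B⊆A y y∈B) x≢y)
           , (λ A⊆B → tower-clique (h B∈C) x y (A⊆B x x∈A) y∈B x≢y)
           ]′ (comparable (h A∈C) (h B∈C))

      towers : Pred (𝒫 P) 0ℓ
      towers A = A ∈ᵇ ⟦ Tower ⟧

      top : Tower (⋃ towers)
      top = sup towers (⟦⟧⁻ Tower)

    clique : 𝒫 P
    clique = ⋃ towers

    clique-isClique : Clique clique
    clique-isClique = tower-clique top

    clique-maximal : ∀ p → Extends clique p → p ∈ᵇ clique
    clique-maximal p ext = byContra λ p∉ →
      next-fixed clique (⋃-upper towers (⟦⟧⁺ Tower (step top))) (p , p∉ , ext)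

  -- Take a maximal set of elements of the product of all members of S that
  -- pairwise differ in every coordinate.  Some projection of it is onto,
  -- and all projections are injective.

  least-exists : (S : Pred Set ℓ) → Satisfiable S → ∃ (IsLeast S)
  least-exists S (κ₀ , κ₀∈S) = proj₁ i , record
    { member = proj₂ i
    ; lower  = λ μ μ∈S → mk↣ {to = λ x → proj₁ (onto x) (μ , μ∈S)} (injective (μ , μ∈S))
    }
    where
    Π : Set _
    Π = (i : ∃ S) → proj₁ i

    _~_ : Π → Π → Set _
    f ~ g = ∀ i → f i ≢ g i

    open MaximalClique _~_ (λ f~g i eq → f~g i (sym eq))

    Onto : ∃ S → Set _
    Onto i = ∀ x → ∃[ f ] f ∈ᵇ clique × f i ≡ x

    some-onto : ∃ Onto
    some-onto = byContra λ none →
      let missed : ∀ i → ∃[ x ] ¬ (∃[ f ] f ∈ᵇ clique × f i ≡ x)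
          missed i = ¬∀⇒∃¬ λ onto → none (i , onto)
          p : Π
          p i = proj₁ (missed i)
          p~ : Extends clique p
          p~ f f∈ i eq = proj₂ (missed i) (f , f∈ , sym eq)
      in p~ p (clique-maximal p p~) (κ₀ , κ₀∈S) refl

    i    = proj₁ some-onto
    onto = proj₂ some-onto

    injective : ∀ j {x y} → proj₁ (onto x) j ≡ proj₁ (onto y) j → x ≡ y
    injective j {x} {y} eq with onto x | onto y
    ... | f , f∈ , fi≡x | g , g∈ , gi≡y with em {P = f ≡ g}
    ...   | yes f≡g = trans (sym fi≡x) (trans (cong-app f≡g i) gi≡y)
    ...   | no  f≢g = ⊥-elim (clique-isClique f g f∈ g∈ f≢g j eq)

  least : (S : Pred Set ℓ) → Satisfiable S → Set
  least S s = proj₁ (least-exists S s)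

  least-isLeast : (S : Pred Set ℓ) (s : Satisfiable S) → IsLeast S (least S s)
  least-isLeast S s = proj₂ (least-exists S s)

  cantor : (κ : Set) → κ ≺ 𝒫 κ
  cantor κ = mk↣ {to = singleton} singleton-injective , no-injection
    where
    open Function.Injection using (to; injective)

    singleton : κ → 𝒫 κ
    singleton x = ⟦ x ≡_ ⟧

    singleton-injective : ∀ {x y} → singleton x ≡ singleton y → x ≡ y
    singleton-injective {x} {y} eq =
      sym (⟦⟧⁻ (y ≡_) (subst (x ∈ᵇ_) eq (⟦⟧⁺ (x ≡_) refl)))

    no-injection : ¬ (𝒫 κ ≼ κ)
    no-injection inj = d∉D (⟦⟧⁺ Diagonal (D , refl , d∉D))
      where
      Diagonal : κ → Set
      Diagonal x = ∃[ A ] to inj A ≡ x × ¬ (x ∈ᵇ A)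

      D : 𝒫 κ
      D = ⟦ Diagonal ⟧

      d∉D : ¬ (to inj D ∈ᵇ D)
      d∉D d∈D with ⟦⟧⁻ Diagonal d∈D
      ... | A , eq , d∉A with injective inj eq
      ...   | refl = d∉A d∈D

  infix 30 _⁺

  _⁺ : Set → Set
  κ ⁺ = least (κ ≺_) (𝒫 κ , cantor κ)

  𝔲 : Family → Pred (ℕ → ℕ) 0ℓ → Family → Pred (ℕ → ℕ) 0ℓ → Set
  𝔲 I F J G =
    least ((λ κ → κ ≼ 𝔠 × I ⪯[ κ ∣ F , G ] J) ∪ ｛ 𝔠 ⁺ ｝) (𝔠 ⁺ , inj₂ refl)

{-# OPTIONS --safe #-}

-- Right to left: for an ultrafilter U the only ideal of the form U * ⟨ A ⟩ is
-- U * itself, so U * refutes I ⪯[ κ ∣ F , G ] J for every κ; hence 𝔲 is 𝔠 ⁺,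
-- and ∣ F ∣ ≼ 𝔠.
--
-- Left to right: ∣ F ∣ itself is not among the cardinals defining 𝔲, so some
-- ideal J′ with J ≤[ G ] J′ has I ≰[ F ] J′ ⟨ A ⟩ whenever ∣ A ∣ ≺ ∣ F ∣ and
-- J′ ⟨ A ⟩ is proper.  Well-order F with all initial segments smaller than F
-- and choose recursively B ∈ I whose preimage D f = f ⁻¹ B is not in
-- J′ ⟨ ∁ (D g) ∣ g < f ⟩.  The ideal generated over J′ by all complements
-- ∁ (D f) is then proper, and no f ∈ F reduces I to an ideal extending it; U *
-- is any maximal one.  That a maximal one exists follows from the same
-- recursion, now along a well-order of 𝒫 ℕ, with D B one of B and ∁ B.

module Submission where

open import Defs
open import Axiom.ExcludedMiddle using (ExcludedMiddle)
open import Axiom.Extensionality.Propositional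
  using (Extensionality; implicit-extensionality)
open import Data.Bool using (true; false; T; not; _∨_)
open import Data.Bool.Properties using (T-∧; T-∨; not-involutive; ∨-∧-booleanAlgebra)
open import Algebra.Lattice.Properties.BooleanAlgebra ∨-∧-booleanAlgebra using (deMorgan₁)
open import Data.Empty using (⊥-elim)
open import Data.Irrelevant using ([_])
open import Data.List using (List; []; _∷_; _++_)
open import Data.List.Relation.Unary.All as All using (All; []; _∷_)
import Data.List.Relation.Unary.All.Properties as All
open import Data.Nat using (ℕ; zero; suc; _*_)
open import Data.Nat.Properties using (suc-injective; *-cancelˡ-≡; even≢odd)
open import Data.Product using (∃; ∃-syntax; Σ-syntax; _×_; _,_; proj₁; proj₂)
open import Data.Refinement using (value; value-injective; _,_)
open import Data.Sum using (_⊎_; inj₁; inj₂; [_,_]′)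
open import Data.Unit using (tt)
open import Function using (id; _∘_; _⇔_; mk⇔; mk↣)
open import Function.Bundles using (module Equivalence; module Injection)
open import Function.Construct.Composition using (_↣-∘_)
open import Induction.WellFounded as WF using (WellFounded; Acc; acc)
open import Level using (Level; 0ℓ)
import Relation.Binary.Construct.On as On
open import Relation.Binary.PropositionalEquality
  using (_≡_; refl; sym; trans; cong; subst)
open import Relation.Nullary using (¬_; yes; no; recompute)
open import Relation.Nullary.Decidable using (⌊_⌋; toWitness; fromWitness)
open import Relation.Unary using (Pred; _∈_; _∉_; _∪_; ｛_｝; U)

open Injection using (to; injective)

private
  variable
    a ℓ : Level
    X : Set a

-- Membership in Boolean-valued subsets.

T-not⁻ : ∀ {b} → T (not b) → ¬ T b
T-not⁻ {false} _ ()

T-not⁺ : ∀ {b} → ¬ T b → T (not b)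
T-not⁺ {false} _  = tt
T-not⁺ {true}  ¬b = ¬b tt

T-antisym : ∀ {b c} → (T b → T c) → (T c → T b) → b ≡ c
T-antisym {false} {false} _ _ = refl
T-antisym {false} {true}  _ g = ⊥-elim (g tt)
T-antisym {true}  {false} f _ = ⊥-elim (f tt)
T-antisym {true}  {true}  _ _ = refl

∪⁺ : (A B : 𝒫 X) → ∀ {x} → x ∈ᵇ A ⊎ x ∈ᵇ B → x ∈ᵇ (A ∪ᵇ B)
∪⁺ _ _ = Equivalence.from T-∨

∪⁻ : (A B : 𝒫 X) → ∀ {x} → x ∈ᵇ (A ∪ᵇ B) → x ∈ᵇ A ⊎ x ∈ᵇ B
∪⁻ _ _ = Equivalence.to T-∨

∖⁺ : (A B : 𝒫 X) → ∀ {x} → x ∈ᵇ A → ¬ x ∈ᵇ B → x ∈ᵇ (A ∖ᵇ B)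
∖⁺ _ _ x∈A x∉B = Equivalence.from T-∧ (x∈A , T-not⁺ x∉B)

∖⁻ : (A B : 𝒫 X) → ∀ {x} → x ∈ᵇ (A ∖ᵇ B) → x ∈ᵇ A × ¬ x ∈ᵇ B
∖⁻ _ _ x∈ = let (x∈A , x∉B) = Equivalence.to T-∧ x∈ in x∈A , T-not⁻ x∉B

∖-⊆ : (A B C D : 𝒫 X) →
      (∀ {x} → x ∈ᵇ A → ¬ x ∈ᵇ B → x ∈ᵇ C × ¬ x ∈ᵇ D) → (A ∖ᵇ B) ⊆ᵇ (C ∖ᵇ D)
∖-⊆ A B C D h x x∈ =
  let (x∈A , x∉B) = ∖⁻ A B x∈
      (x∈C , x∉D) = h x∈A x∉B
  in ∖⁺ C D x∈C x∉D

∪-least : (A B C : 𝒫 X) → A ⊆ᵇ C → B ⊆ᵇ C → (A ∪ᵇ B) ⊆ᵇ C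
∪-least A B C A⊆C B⊆C x = [ A⊆C x , B⊆C x ]′ ∘ ∪⁻ A B

∪-monoʳ : (A B C : 𝒫 X) → B ⊆ᵇ C → (A ∪ᵇ B) ⊆ᵇ (A ∪ᵇ C)
∪-monoʳ A B C B⊆C = ∪-least A B (A ∪ᵇ C)
  (λ _ → ∪⁺ A C ∘ inj₁) (λ x → ∪⁺ A C ∘ inj₂ ∘ B⊆C x)

∪-exchange : (A B C D : 𝒫 X) → B ⊆ᵇ (C ∪ᵇ D) → (A ∪ᵇ B) ⊆ᵇ (C ∪ᵇ (A ∪ᵇ D))
∪-exchange A B C D B⊆ = ∪-least A B (C ∪ᵇ (A ∪ᵇ D))
  (λ _ → ∪⁺ C (A ∪ᵇ D) ∘ inj₂ ∘ ∪⁺ A D ∘ inj₁)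
  (λ x → ∪-monoʳ C D (A ∪ᵇ D) (λ _ → ∪⁺ A D ∘ inj₂) x ∘ B⊆ x)

⋃-++ˡ : (As Bs : List (𝒫 X)) → ⋃ᵇ As ⊆ᵇ ⋃ᵇ (As ++ Bs)
⋃-++ˡ (A ∷ As) Bs x x∈ =
  ∪⁺ A (⋃ᵇ (As ++ Bs)) ([ inj₁ , inj₂ ∘ ⋃-++ˡ As Bs x ]′ (∪⁻ A (⋃ᵇ As) x∈))

⋃-++ʳ : (As Bs : List (𝒫 X)) → ⋃ᵇ Bs ⊆ᵇ ⋃ᵇ (As ++ Bs)
⋃-++ʳ []       Bs x x∈ = x∈
⋃-++ʳ (A ∷ As) Bs x x∈ = ∪⁺ A (⋃ᵇ (As ++ Bs)) (inj₂ (⋃-++ʳ As Bs x x∈))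

-- The ideal generated over `K` by a family.

module _ {K : Family} (K-ideal : IsIdeal K) {A : Family} where

  open IsIdeal K-ideal

  ⟨⟩-⊆-closed : ∀ {B C} → B ⊆ᵇ C → C ∈ K ⟨ A ⟩ → B ∈ K ⟨ A ⟩
  ⟨⟩-⊆-closed {B} {C} B⊆C (Cs , Cs⊆A , C∈) =
    Cs , Cs⊆A , ⊆-closed (∖-⊆ B (⋃ᵇ Cs) C (⋃ᵇ Cs) λ x∈ x∉ → B⊆C _ x∈ , x∉) C∈

  ⟨⟩-∪-closed : ∀ {B C} → B ∈ K ⟨ A ⟩ → C ∈ K ⟨ A ⟩ → (B ∪ᵇ C) ∈ K ⟨ A ⟩
  ⟨⟩-∪-closed {B} {C} (Bs , Bs⊆A , B∈) (Cs , Cs⊆A , C∈) =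
    Bs ++ Cs , All.++⁺ Bs⊆A Cs⊆A , ⊆-closed incl (∪-closed B∈ C∈)
    where
    incl : ((B ∪ᵇ C) ∖ᵇ ⋃ᵇ (Bs ++ Cs)) ⊆ᵇ ((B ∖ᵇ ⋃ᵇ Bs) ∪ᵇ (C ∖ᵇ ⋃ᵇ Cs))
    incl x x∈ =
      let (x∈B∪C , x∉) = ∖⁻ (B ∪ᵇ C) (⋃ᵇ (Bs ++ Cs)) x∈
      in ∪⁺ (B ∖ᵇ ⋃ᵇ Bs) (C ∖ᵇ ⋃ᵇ Cs)
        ([ (λ x∈B → inj₁ (∖⁺ B (⋃ᵇ Bs) x∈B (x∉ ∘ ⋃-++ˡ Bs Cs x)))
         , (λ x∈C → inj₂ (∖⁺ C (⋃ᵇ Cs) x∈C (x∉ ∘ ⋃-++ʳ Bs Cs x)))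
         ]′ (∪⁻ B C x∈B∪C))

  ⟨⟩-⊇ : ∀ {B} → B ∈ K → B ∈ K ⟨ A ⟩
  ⟨⟩-⊇ {B} B∈K = [] , [] , ⊆-closed (λ x → proj₁ ∘ ∖⁻ B ∅ᵇ) B∈K

  ⟨⟩-generator : ∀ {B} → B ∈ A → B ∈ K ⟨ A ⟩
  ⟨⟩-generator {B} B∈A = B ∷ [] , B∈A ∷ [] , finite ([] , λ x x∈ →
    let (x∈B , x∉B) = ∖⁻ B (B ∪ᵇ ∅ᵇ) x∈ in ⊥-elim (x∉B (∪⁺ B ∅ᵇ (inj₁ x∈B))))

  ⟨⟩-isIdeal : full ∉ K ⟨ A ⟩ → IsIdeal (K ⟨ A ⟩)
  ⟨⟩-isIdeal full∉ = record
    { ⊆-closed = ⟨⟩-⊆-closed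
    ; ∪-closed = ⟨⟩-∪-closed
    ; finite   = ⟨⟩-⊇ ∘ finite
    ; proper   = full∉
    }

ideal-complement : ∀ {K B} → IsIdeal K → B ∈ K → ∁ᵇ B ∉ K
ideal-complement {B = B} K-ideal B∈ ∁B∈ =
  proper (⊆-closed (λ x _ → total (B x)) (∪-closed B∈ ∁B∈))
  where
  open IsIdeal K-ideal
  total : ∀ b → T (b ∨ not b)
  total false = tt
  total true  = tt

-- Cardinals, well-orders and complements indexed along them.

≼-≺-trans : ∀ {κ μ ν} → κ ≼ μ → μ ≺ ν → κ ≺ ν
≼-≺-trans κ≼μ (μ≼ν , ν⋠μ) = μ≼ν ↣-∘ κ≼μ , λ ν≼κ → ν⋠μ (κ≼μ ↣-∘ ν≼κ)

record WellOrder (X : Set) : Set₁ where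
  infix 4 _<_
  field
    _<_           : X → X → Set
    <-trans       : ∀ {x y z} → x < y → y < z → x < z
    <-compare     : ∀ x y → x < y ⊎ x ≡ y ⊎ y < x
    <-wellFounded : WellFounded _<_

  below : X → Pred X 0ℓ
  below x y = y < x

pullback : {X Y : Set} → X ≼ Y → WellOrder Y → WellOrder X
pullback i W = record
  { _<_           = λ x y → to i x < to i y
  ; <-trans       = <-trans
  ; <-compare     = λ x y → [ inj₁ , inj₂ ∘ [ inj₁ ∘ injective i , inj₂ ]′ ]′
                              (<-compare (to i x) (to i y))
  ; <-wellFounded = On.wellFounded (to i) <-wellFounded
  }
  where open WellOrder W

∁-image : {X : Set} → (X → 𝒫 ℕ) → Pred X 0ℓ → Family
∁-image D S B = ∃[ x ] x ∈ S × B ≡ ∁ᵇ (D x)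

module _ {X : Set} (W : WellOrder X) (D : X → 𝒫 ℕ) {S : Pred X 0ℓ} where

  open WellOrder W

  -- Induction on the list, keeping the greatest index `m` apart. A new index below `m` joins `Cs`,
  -- one equal to `m` is absorbed, and one above `m` takes its place and sends `m` to `Cs`.
  split-greatest :
    ∀ Bs → All (∁-image D S) Bs →
    Bs ≡ [] ⊎
    ∃[ m ] m ∈ S × ∃[ Cs ] All (∁-image D (below m)) Cs ×
      ⋃ᵇ Bs ⊆ᵇ (∁ᵇ (D m) ∪ᵇ ⋃ᵇ Cs)
  split-greatest [] [] = inj₁ refl
  split-greatest (_ ∷ Bs) ((y , y∈S , refl) ∷ rest) with split-greatest Bs rest
  ... | inj₁ refl = inj₂ (y , y∈S , [] , [] , λ _ → id)
  ... | inj₂ (m , m∈S , Cs , Cs< , sub) with <-compare y m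
  ...   | inj₁ y<m =
    inj₂ (m , m∈S , ∁ᵇ (D y) ∷ Cs , (y , y<m , refl) ∷ Cs<
         , ∪-exchange (∁ᵇ (D y)) (⋃ᵇ Bs) (∁ᵇ (D m)) (⋃ᵇ Cs) sub)
  ...   | inj₂ (inj₁ refl) =
    inj₂ (m , m∈S , Cs , Cs<
         , ∪-least (∁ᵇ (D m)) (⋃ᵇ Bs) (∁ᵇ (D m) ∪ᵇ ⋃ᵇ Cs)
             (λ _ → ∪⁺ (∁ᵇ (D m)) (⋃ᵇ Cs) ∘ inj₁) sub)
  ...   | inj₂ (inj₂ m<y) =
    inj₂ (y , y∈S , ∁ᵇ (D m) ∷ Cs
         , (m , m<y , refl) ∷ All.map (λ (z , z<m , eq) → z , <-trans z<m m<y , eq) Cs<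
         , ∪-monoʳ (∁ᵇ (D y)) (⋃ᵇ Bs) (∁ᵇ (D m) ∪ᵇ ⋃ᵇ Cs) sub)

  -- A cover of `full` modulo `K` by finitely many complements has a greatest index `m`. Since `D m`
  -- is disjoint from `∁ᵇ (D m)`, it is covered modulo `K` by the complements with smaller indices,
  -- which the hypothesis on `D m` forbids.
  ∁-image-proper :
    ∀ {K} → IsIdeal K → (∀ {x} → x ∈ S → D x ∉ K ⟨ ∁-image D (below x) ⟩) →
    full ∉ K ⟨ ∁-image D S ⟩
  ∁-image-proper K-ideal D∉ (Bs , Bs∈ , full∖∈K) with split-greatest Bs Bs∈
  ... | inj₁ refl = IsIdeal.proper K-ideal full∖∈K
  ... | inj₂ (m , m∈S , Cs , Cs< , sub) =
    D∉ m∈S (Cs , Cs< , IsIdeal.⊆-closed K-ideal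
      (∖-⊆ (D m) (⋃ᵇ Cs) full (⋃ᵇ Bs) λ x∈D x∉Cs → tt , λ x∈Bs →
        [ (λ x∉D → T-not⁻ x∉D x∈D) , x∉Cs ]′ (∪⁻ (∁ᵇ (D m)) (⋃ᵇ Cs) (sub _ x∈Bs)))
      full∖∈K)

-- This is the pairing function 2^a (2b + 1) - 1.
code : ℕ → ℕ → ℕ
code zero    b = 2 * b
code (suc a) b = suc (2 * code a b)

code-injective : ∀ a a′ {b b′} → code a b ≡ code a′ b′ → a ≡ a′ × b ≡ b′
code-injective zero zero {b} {b′} eq = refl , *-cancelˡ-≡ b b′ 2 eq
code-injective zero (suc a′) {b} {b′} eq = ⊥-elim (even≢odd b (code a′ b′) eq)
code-injective (suc a) zero {b} {b′} eq = ⊥-elim (even≢odd b′ (code a b) (sym eq))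
code-injective (suc a) (suc a′) {b} {b′} eq
  with code-injective a a′
         (*-cancelˡ-≡ (code a b) (code a′ b′) 2 (suc-injective eq))
... | refl , b≡b′ = refl , b≡b′

module Consequences
  (em : ∀ {ℓ} → ExcludedMiddle ℓ)
  (fe : ∀ {a b} → Extensionality a b)
  where

  -- Classical tools and Zermelo's well-ordering.

  byContra : {P : Set ℓ} → ¬ ¬ P → P
  byContra {P = P} ¬¬p with em {P = P}
  ... | yes p = p
  ... | no ¬p = ⊥-elim (¬¬p ¬p)

  -- The stored proof is irrelevant; excluded middle decides `P`, so a usable proof can be
  -- recomputed.
  member : {P : Pred X ℓ} (x : ∣ P ∣) → value x ∈ P
  member (_ , [ x∈P ]) = recompute em x∈P

  ⟦_⟧ : Pred X ℓ → 𝒫 X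
  ⟦ P ⟧ x = ⌊ em {P = P x} ⌋

  ⟦⟧⁻ : (P : Pred X ℓ) → ∀ {x} → x ∈ᵇ ⟦ P ⟧ → P x
  ⟦⟧⁻ P = toWitness

  ⟦⟧⁺ : (P : Pred X ℓ) → ∀ {x} → P x → x ∈ᵇ ⟦ P ⟧
  ⟦⟧⁺ P = fromWitness

  ⊆ᵇ-antisym : {A B : 𝒫 X} → A ⊆ᵇ B → B ⊆ᵇ A → A ≡ B
  ⊆ᵇ-antisym A⊆B B⊆A = fe λ x → T-antisym (A⊆B x) (B⊆A x)

  ∁ᵇ-involutive : (A : 𝒫 X) → ∁ᵇ (∁ᵇ A) ≡ A
  ∁ᵇ-involutive A = fe λ x → not-involutive (A x)

  -- Zermelo: a set A other than X has one chosen point added to it, and the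
  -- sets obtained by iterating this are nested.  The predecessors of x form
  -- the largest such set avoiding x.
  module Zermelo (X : Set) where

    Missing : 𝒫 X → Set
    Missing A = ∃[ x ] ¬ x ∈ᵇ A

    next : 𝒫 X → 𝒫 X
    next A with em {P = Missing A}
    ... | yes (p , _) = ⟦ (λ x → x ∈ᵇ A ⊎ x ≡ p) ⟧
    ... | no  _       = A

    next-⊇ : ∀ A → A ⊆ᵇ next A
    next-⊇ A x x∈A with em {P = Missing A}
    ... | yes (p , _) = ⟦⟧⁺ (λ x → x ∈ᵇ A ⊎ x ≡ p) (inj₁ x∈A)
    ... | no  _       = x∈A

    next-unique : ∀ A {x y} → x ∈ᵇ next A → y ∈ᵇ next A →
                  ¬ x ∈ᵇ A → ¬ y ∈ᵇ A → x ≡ y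
    next-unique A x∈ y∈ x∉A y∉A with em {P = Missing A}
    ... | no _ = ⊥-elim (x∉A x∈)
    ... | yes (p , _)
      with ⟦⟧⁻ (λ x → x ∈ᵇ A ⊎ x ≡ p) x∈ | ⟦⟧⁻ (λ x → x ∈ᵇ A ⊎ x ≡ p) y∈
    ...   | inj₁ x∈A | _        = ⊥-elim (x∉A x∈A)
    ...   | inj₂ _   | inj₁ y∈A = ⊥-elim (y∉A y∈A)
    ...   | inj₂ x≡p | inj₂ y≡p = trans x≡p (sym y≡p)

    next-fixed : ∀ A → next A ⊆ᵇ A → ∀ x → x ∈ᵇ A
    next-fixed A ⊆A x with em {P = Missing A}
    ... | yes (p , p∉A) = ⊥-elim (p∉A (⊆A p (⟦⟧⁺ (λ x → x ∈ᵇ A ⊎ x ≡ p) (inj₂ refl))))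
    ... | no ¬missing = byContra λ x∉A → ¬missing (x , x∉A)

    ⋃next : 𝒫 (𝒫 X) → 𝒫 X
    ⋃next C = ⟦ (λ x → ∃[ A ] A ∈ᵇ C × x ∈ᵇ next A) ⟧

    ⋃next-upper : ∀ C {A} → A ∈ᵇ C → next A ⊆ᵇ ⋃next C
    ⋃next-upper C {A} A∈C x x∈ = ⟦⟧⁺ (λ x → ∃[ A ] A ∈ᵇ C × x ∈ᵇ next A) (A , A∈C , x∈)

    ⋃next⁻ : ∀ C {x} → x ∈ᵇ ⋃next C → ∃[ A ] A ∈ᵇ C × x ∈ᵇ next A
    ⋃next⁻ C = ⟦⟧⁻ (λ x → ∃[ A ] A ∈ᵇ C × x ∈ᵇ next A)

    -- One constructor covers every stage: the empty family gives the empty set, a single `A` gives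
    -- `next A`, and larger families give limits. Boolean-valued families keep the type in `Set`.
    data Tower : 𝒫 X → Set where
      sup : ∀ C → (∀ {A} → A ∈ᵇ C → Tower A) → Tower (⋃next C)

    -- If some stage `Z` of `A` has `next Z` not inside `B`, comparing `Z` with `B` both ways leaves
    -- either `next B` inside `Z` or `Z` equal to `B`. The swapped call is justified because one of
    -- the two towers has become smaller.
    compare : ∀ {A B} → Tower A → Tower B → A ⊆ᵇ B ⊎ next B ⊆ᵇ A
    compare {B = B} (sup C h) t with em {P = ∃[ Z ] Z ∈ᵇ C × ¬ next Z ⊆ᵇ B}
    ... | no none = inj₁ λ x x∈ →
      let (Z , Z∈C , x∈Z) = ⋃next⁻ C x∈
      in byContra λ x∉B → none (Z , Z∈C , λ Z⊆B → x∉B (Z⊆B x x∈Z))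
    ... | yes (Z , Z∈C , Z⊈B) with compare (h Z∈C) t
    ...   | inj₂ B⊆Z = inj₂ λ x x∈ → ⋃next-upper C Z∈C x (next-⊇ Z x (B⊆Z x x∈))
    ...   | inj₁ Z⊆B with compare t (h Z∈C)
    ...     | inj₂ Z⊆B′ = ⊥-elim (Z⊈B Z⊆B′)
    ...     | inj₁ B⊆Z with ⊆ᵇ-antisym B⊆Z Z⊆B
    ...       | refl = inj₂ (⋃next-upper C Z∈C)

    Avoids : X → Pred (𝒫 X) 0ℓ
    Avoids x A = Tower A × ¬ x ∈ᵇ next A

    pre : X → 𝒫 X
    pre x = ⋃next ⟦ Avoids x ⟧

    pre-tower : ∀ x → Tower (pre x)
    pre-tower x = sup ⟦ Avoids x ⟧ (proj₁ ∘ ⟦⟧⁻ (Avoids x))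

    ∉pre : ∀ x → ¬ x ∈ᵇ pre x
    ∉pre x x∈ = let (A , A∈ , x∈A) = ⋃next⁻ ⟦ Avoids x ⟧ x∈
                in proj₂ (⟦⟧⁻ (Avoids x) A∈) x∈A

    -- Otherwise `pre x` would itself avoid `x`, so `next (pre x)` would lie inside `pre x`; such a
    -- fixed point is all of `X`.
    ∈next-pre : ∀ x → x ∈ᵇ next (pre x)
    ∈next-pre x = byContra λ x∉ → ∉pre x (next-fixed (pre x)
      (⋃next-upper ⟦ Avoids x ⟧ (⟦⟧⁺ (Avoids x) (pre-tower x , x∉))) x)

    infix 4 _<_

    _<_ : X → X → Set
    x < y = x ∈ᵇ pre y

    trans-< : ∀ {x y z} → x < y → y < z → x < z
    trans-< {x} {y} {z} x<y y<z with compare (pre-tower y) (pre-tower z)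
    ... | inj₁ ⊆z = ⊆z x x<y
    ... | inj₂ ⊆y = ⊥-elim (∉pre y (⊆y y (next-⊇ (pre z) y y<z)))

    pre-⊆ : ∀ {x y} → ¬ y < x → pre x ⊆ᵇ pre y
    pre-⊆ {x} {y} y≮x with compare (pre-tower x) (pre-tower y)
    ... | inj₁ x⊆y = x⊆y
    ... | inj₂ y⊆x = ⊥-elim (y≮x (y⊆x y (∈next-pre y)))

    compare-< : ∀ x y → x < y ⊎ x ≡ y ⊎ y < x
    compare-< x y with em {P = x < y} | em {P = y < x}
    ... | yes x<y | _       = inj₁ x<y
    ... | no  _   | yes y<x = inj₂ (inj₂ y<x)
    -- Incomparable points have the same predecessors, and `next` adds at most one point.
    ... | no  x≮y | no  y≮x = inj₂ (inj₁ (next-unique (pre y)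
      (subst (λ A → x ∈ᵇ next A) (⊆ᵇ-antisym (pre-⊆ y≮x) (pre-⊆ x≮y)) (∈next-pre x))
      (∈next-pre y) x≮y (∉pre y)))

    -- A point new in `next A` has all its predecessors in `A`, for otherwise `next A` would lie
    -- inside `pre x` and `x` would precede itself.
    accessible-next : ∀ {A} → Tower A → (∀ {x} → x ∈ᵇ A → Acc _<_ x) →
                      ∀ {x} → x ∈ᵇ next A → Acc _<_ x
    accessible-next {A} t acc-A {x} x∈ with em {P = x ∈ᵇ A}
    ... | yes x∈A = acc-A x∈A
    ... | no  x∉A with compare (pre-tower x) t
    ...   | inj₁ pre⊆A = acc λ y<x → acc-A (pre⊆A _ y<x)
    ...   | inj₂ next⊆ = ⊥-elim (∉pre x (next⊆ x x∈))

    accessible : ∀ {A} → Tower A → ∀ {x} → x ∈ᵇ A → Acc _<_ x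
    accessible (sup C h) x∈ =
      let (A , A∈C , x∈A) = ⋃next⁻ C x∈
      in accessible-next (h A∈C) (accessible (h A∈C)) x∈A

    wellOrder : WellOrder X
    wellOrder = record
      { _<_           = _<_
      ; <-trans       = trans-<
      ; <-compare     = compare-<
      ; <-wellFounded = λ x →
          accessible-next (pre-tower x) (accessible (pre-tower x)) (∈next-pre x)
      }

  minimal : {_<_ : X → X → Set} → WellFounded _<_ → (P : Pred X ℓ) → ∃ P →
            ∃[ m ] m ∈ P × (∀ {y} → y < m → y ∉ P)
  minimal {_<_ = _<_} wf P (x , x∈P) = go x (wf x) x∈P
    where
    go : ∀ x → Acc _<_ x → x ∈ P → ∃[ m ] m ∈ P × (∀ {y} → y < m → y ∉ P)
    go x (acc rs) x∈P with em {P = ∃[ y ] y < x × y ∈ P}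
    ... | yes (y , y<x , y∈P) = go y (rs y<x) y∈P
    ... | no none = x , x∈P , λ y<x y∈P → none (_ , y<x , y∈P)

  -- Well-orders whose initial segments are all small.

  HasLargeSegment : {X : Set} → WellOrder X → X → Set
  HasLargeSegment {X} W x = X ≼ ∣ WellOrder.below W x ∣

  -- X embeds into its least large initial segment, and the order induced by
  -- this embedding has no large initial segment.
  shrink : {X : Set} (W : WellOrder X) (m : X) → HasLargeSegment W m →
           (∀ {y} → WellOrder._<_ W y m → ¬ HasLargeSegment W y) →
           Σ[ W′ ∈ WellOrder X ] (∀ x → ¬ HasLargeSegment W′ x)
  shrink {X} W m j minimal-m = pullback i W , λ x X≼x →
    minimal-m (member (to j x)) (segment x ↣-∘ X≼x)
    where
    open WellOrder W using (below)

    i : X ≼ X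
    i = mk↣ {to = value ∘ to j} (injective j ∘ value-injective)

    segment : ∀ x → ∣ WellOrder.below (pullback i W) x ∣ ≼ ∣ below (to i x) ∣
    segment x = mk↣ {to = λ (y , y<x) → to i y , y<x}
      λ eq → value-injective (injective i (cong value eq))

  -- Shrinking at the least point with a large segment, if there is one, yields an order whose type
  -- is the initial ordinal of `X`.
  initial-wellOrder : (X : Set) →
    Σ[ W ∈ WellOrder X ] (∀ x → ¬ HasLargeSegment W x)
  initial-wellOrder X = go (Zermelo.wellOrder X)
    where
    go : WellOrder X → Σ[ W ∈ WellOrder X ] (∀ x → ¬ HasLargeSegment W x)
    go W with em {P = ∃ (HasLargeSegment W)}
    ... | no none = W , λ x large → none (x , large)
    ... | yes some =
      let (m , m-large , m-minimal) =
            minimal (WellOrder.<-wellFounded W) (HasLargeSegment W) some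
      in shrink W m m-large m-minimal

  -- Several indices may share a complement, so each set is sent back to one of its indices, which
  -- determines it.
  ∁-image-≼ : {X : Set} (D : X → 𝒫 ℕ) (S : Pred X 0ℓ) → ∣ ∁-image D S ∣ ≼ ∣ S ∣
  ∁-image-≼ D S = mk↣ {to = λ B → proj₁ (index B) , [ proj₁ (proj₂ (index B)) ]} λ {B} {C} eq →
    value-injective (trans (proj₂ (proj₂ (index B)))
      (trans (cong (∁ᵇ ∘ D) (cong value eq)) (sym (proj₂ (proj₂ (index C))))))
    where
    index : (B : ∣ ∁-image D S ∣) → value B ∈ ∁-image D S
    index = member

  value-≼ : {X : Set} (S : Pred X 0ℓ) → ∣ S ∣ ≼ X
  value-≼ S = mk↣ {to = value} value-injective

  -- Recursive choice of sets outside the ideal generated so far.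

  module Recursion
    {X : Set} (W : WellOrder X) {K : Family} (K-ideal : IsIdeal K)
    (Allowed : X → Pred (𝒫 ℕ) 0ℓ)
    (step : ∀ x D → full ∉ K ⟨ ∁-image D (WellOrder.below W x) ⟩ →
            ∃[ C ] C ∈ Allowed x × C ∉ K ⟨ ∁-image D (WellOrder.below W x) ⟩)
    where

    open WellOrder W

    -- The default `∅ᵇ` makes the choice total, so `D` can be defined before the ideals are known to
    -- be proper; `D-spec` shows that the default branch is never taken in building `D`.
    choose : X → Family → 𝒫 ℕ
    choose x A with em {P = ∃[ C ] C ∈ Allowed x × C ∉ K ⟨ A ⟩}
    ... | yes (C , _) = C
    ... | no  _       = ∅ᵇ

    choose-spec : ∀ x A → ∃[ C ] C ∈ Allowed x × C ∉ K ⟨ A ⟩ →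
                  choose x A ∈ Allowed x × choose x A ∉ K ⟨ A ⟩
    choose-spec x A some with em {P = ∃[ C ] C ∈ Allowed x × C ∉ K ⟨ A ⟩}
    ... | yes (_ , spec) = spec
    ... | no  none       = ⊥-elim (none some)

    body : ∀ x → (∀ {y} → y < x → 𝒫 ℕ) → 𝒫 ℕ
    -- With `D` in place of `rec`, this family is definitionally `∁-image D (below x)`.
    body x rec = choose x λ B → ∃[ y ] Σ[ y<x ∈ y < x ] B ≡ ∁ᵇ (rec y<x)

    body-cong : ∀ x {rec rec′ : ∀ {y} → y < x → 𝒫 ℕ} →
                (∀ {y} (y<x : y < x) → rec y<x ≡ rec′ y<x) → body x rec ≡ body x rec′
    body-cong x eq = cong (λ r → body x (λ {y} → r {y}))
      (implicit-extensionality fe (λ {y} → fe eq))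

    D : X → 𝒫 ℕ
    D = WF.All.wfRec <-wellFounded 0ℓ (λ _ → 𝒫 ℕ) body

    D-unfold : ∀ x → D x ≡ choose x (∁-image D (below x))
    D-unfold x = WF.FixPoint.unfold-wfRec <-wellFounded (λ _ → 𝒫 ℕ) body body-cong

    D-spec : ∀ x → D x ∈ Allowed x × D x ∉ K ⟨ ∁-image D (below x) ⟩
    D-spec = WF.All.wfRec <-wellFounded 0ℓ _ λ x ih →
      -- The induction hypothesis makes the ideal before `x` proper, which is what `step` requires.
      subst (λ C → C ∈ Allowed x × C ∉ K ⟨ ∁-image D (below x) ⟩) (sym (D-unfold x))
        (choose-spec x _ (step x D (∁-image-proper W D K-ideal (proj₂ ∘ ih))))

    D-allowed : ∀ x → D x ∈ Allowed x
    D-allowed = proj₁ ∘ D-spec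

    D-proper : full ∉ K ⟨ ∁-image D U ⟩
    D-proper = ∁-image-proper W D K-ideal λ {x} _ → proj₂ (D-spec x)

  -- Dual ideals and the ultrafilter theorem.

  *-isIdeal : ∀ {V} → IsUltrafilter V → IsIdeal (V *)
  *-isIdeal {V} V-ultra = record
    { ⊆-closed = λ { {A} A⊆B (C , C∈V , refl) →
        ∁ᵇ A , ⊆-closed (λ x x∈C → T-not⁺ λ x∈A → T-not⁻ (A⊆B x x∈A) x∈C) C∈V
             , sym (∁ᵇ-involutive A) }
    ; ∪-closed = λ { (C , C∈V , refl) (D , D∈V , refl) →
        C ∩ᵇ D , ∩-closed C∈V D∈V , fe λ x → sym (deMorgan₁ (C x) (D x)) }
    ; finite   = λ {A} A-finite →
        ∁ᵇ A , cofinite (subst Finite (sym (∁ᵇ-involutive A)) A-finite)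
             , sym (∁ᵇ-involutive A)
    ; proper   = λ (C , C∈V , full≡∁C) → proper
        (⊆-closed (λ x → T-not⁻ (subst (x ∈ᵇ_) full≡∁C tt)) C∈V)
    }
    where open IsUltrafilter V-ultra

  *-prime : ∀ {V} → IsUltrafilter V → ∀ B → B ∈ V * ⊎ ∁ᵇ B ∈ V *
  *-prime V-ultra B with IsUltrafilter.ultra V-ultra B
  ... | inj₁ B∈V  = inj₂ (B , B∈V , refl)
  ... | inj₂ ∁B∈V = inj₁ (∁ᵇ B , ∁B∈V , sym (∁ᵇ-involutive B))

  -- If `B` were outside `V *`, its complement would be in `V *`, and `K` would contain both.
  *-maximal : ∀ {V K} → IsUltrafilter V → IsIdeal K → (∀ {B} → B ∈ V * → B ∈ K) →
              ∀ {B} → B ∈ K → B ∈ V *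
  *-maximal V-ultra K-ideal V*⊆K {B} B∈K with *-prime V-ultra B
  ... | inj₁ B∈V*  = B∈V*
  ... | inj₂ ∁B∈V* = ⊥-elim (ideal-complement K-ideal B∈K (V*⊆K ∁B∈V*))

  ultrafilter-extension : ∀ {K} → IsIdeal K →
    Σ[ V ∈ Family ] IsUltrafilter V × (∀ {B} → B ∈ K → B ∈ V *)
  ultrafilter-extension {K} K-ideal =
    V , V-ultra , λ {B} B∈K →
      ∁ᵇ B , ⟨⟩-⊇ K-ideal (subst K (sym (∁ᵇ-involutive B)) B∈K) , sym (∁ᵇ-involutive B)
    where
    W = Zermelo.wellOrder (𝒫 ℕ)

    open WellOrder W using (below)

    Decides : 𝒫 ℕ → Pred (𝒫 ℕ) 0ℓ
    Decides B C = C ≡ B ⊎ C ≡ ∁ᵇ B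

    decide : ∀ B D → full ∉ K ⟨ ∁-image D (below B) ⟩ →
             ∃[ C ] C ∈ Decides B × C ∉ K ⟨ ∁-image D (below B) ⟩
    decide B D full∉ with em {P = B ∈ K ⟨ ∁-image D (below B) ⟩}
    ... | no  B∉ = B , inj₁ refl , B∉
    ... | yes B∈ = ∁ᵇ B , inj₂ refl , ideal-complement (⟨⟩-isIdeal K-ideal full∉) B∈

    open Recursion W K-ideal Decides decide

    open IsIdeal (⟨⟩-isIdeal K-ideal D-proper)

    V : Family
    V B = ∁ᵇ B ∈ K ⟨ ∁-image D U ⟩

    V-ultra : IsUltrafilter V
    V-ultra = record
      { ⊆-closed = λ A⊆B → ⊆-closed (λ x x∉B → T-not⁺ (T-not⁻ x∉B ∘ A⊆B x))
      ; ∩-closed = λ {A} {B} A∈V B∈V →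
          ⊆-closed (λ x → subst T (deMorgan₁ (A x) (B x))) (∪-closed A∈V B∈V)
      ; cofinite = finite
      ; proper   = proper
      ; ultra    = λ B → [ (λ eq → inj₁ (subst V eq (D∈V B)))
                         , (λ eq → inj₂ (subst V eq (D∈V B))) ]′ (D-allowed B)
      }
      where
      -- The complement of `D B` is a generator. As `D B` is `B` or `∁ᵇ B`, this decides every set.
      D∈V : ∀ B → D B ∈ V
      D∈V B = ⟨⟩-generator K-ideal (B , _ , refl)

  -- A function is sent to its graph, coded as a set of natural numbers.
  functions-≼-𝔠 : (F : Pred (ℕ → ℕ) 0ℓ) → ∣ F ∣ ≼ 𝔠
  functions-≼-𝔠 F = mk↣ {to = graph ∘ value} (value-injective ∘ graph-injective)
    where
    InGraph : (ℕ → ℕ) → Pred ℕ 0ℓ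
    InGraph f n = ∃[ k ] n ≡ code k (f k)

    graph : (ℕ → ℕ) → 𝒫 ℕ
    graph f = ⟦ InGraph f ⟧

    graph-injective : ∀ {f g} → graph f ≡ graph g → f ≡ g
    graph-injective {f} {g} eq = fe λ k → agree k
      (⟦⟧⁻ (InGraph g) (subst (code k (f k) ∈ᵇ_) eq (⟦⟧⁺ (InGraph f) (k , refl))))
      where
      agree : ∀ k → code k (f k) ∈ InGraph g → f k ≡ g k
      agree k (k′ , eq′) with code-injective k k′ eq′
      ... | refl , fk≡gk = fk≡gk

  open Classical em fe

  𝔠≺𝔠⁺ : 𝔠 ≺ 𝔠 ⁺
  𝔠≺𝔠⁺ = IsLeast.member (least-isLeast (𝔠 ≺_) (𝒫 𝔠 , cantor 𝔠))

  -- Ultrafilters and the cardinal `𝔲`: the two implications.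

  module _ {I J : Family} {F G : Pred (ℕ → ℕ) 0ℓ} where

    Candidate : Pred Set _
    Candidate = (λ κ → κ ≼ 𝔠 × I ⪯[ κ ∣ F , G ] J) ∪ ｛ 𝔠 ⁺ ｝

    𝔲-isLeast : IsLeast Candidate (𝔲 I F J G)
    𝔲-isLeast = least-isLeast Candidate (𝔠 ⁺ , inj₂ refl)

    𝔲-member : 𝔲 I F J G ∈ Candidate
    𝔲-member = IsLeast.member 𝔲-isLeast

    ultrafilter⇒⋠ : ∀ {V κ} → IsUltrafilter V → ¬ (I ≤[ F ] V *) → J ≤[ G ] V * →
                    ¬ (I ⪯[ κ ∣ F , G ] J)
    ultrafilter⇒⋠ {V} V-ultra I≰ J≤ I⪯J =
      let (A , _ , full∉ , f , f∈F , f⁻¹) = I⪯J (V *) (*-isIdeal V-ultra) J≤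
          V*-ideal = *-isIdeal V-ultra
      in I≰ (f , f∈F , λ B B∈I →
           *-maximal V-ultra (⟨⟩-isIdeal V*-ideal full∉) (⟨⟩-⊇ V*-ideal) (f⁻¹ B B∈I))

    ultrafilter⇒≺𝔲 : ∀ {V} → IsUltrafilter V → ¬ (I ≤[ F ] V *) → J ≤[ G ] V * →
                     ∣ F ∣ ≺ 𝔲 I F J G
    ultrafilter⇒≺𝔲 V-ultra I≰ J≤ =
      [ (λ (_ , I⪯J) → ⊥-elim (ultrafilter⇒⋠ V-ultra I≰ J≤ I⪯J))
      , (λ 𝔠⁺≡𝔲 → subst (∣ F ∣ ≺_) 𝔠⁺≡𝔲 (≼-≺-trans (functions-≼-𝔠 F) 𝔠≺𝔠⁺))
      ]′ 𝔲-member

    avoiding-ultrafilter : ∀ {K} → IsIdeal K →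
      (∀ A → ∣ A ∣ ≺ ∣ F ∣ → full ∉ K ⟨ A ⟩ → ¬ (I ≤[ F ] K ⟨ A ⟩)) →
      Σ[ V ∈ Family ] IsUltrafilter V × ¬ (I ≤[ F ] V *) × (∀ {B} → B ∈ K → B ∈ V *)
    avoiding-ultrafilter {K} K-ideal none =
      let (V , V-ultra , M⊆V*) = ultrafilter-extension (⟨⟩-isIdeal K-ideal D-proper)
          V*-ideal = *-isIdeal V-ultra

          I≰ : ¬ (I ≤[ F ] V *)
          I≰ = λ (f , f∈F , f⁻¹) →
            let x = f , [ f∈F ]
                (B , B∈I , D≡) = D-allowed x
            -- A reduction `f` would put the chosen preimage `D x` into `V *`, which already
            -- contains its complement as a generator.
            in ideal-complement V*-ideal (subst (V *) (sym D≡) (f⁻¹ B B∈I))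
                 (M⊆V* (⟨⟩-generator K-ideal (x , _ , refl)))
      in V , V-ultra , I≰ , M⊆V* ∘ ⟨⟩-⊇ K-ideal
      where
      W = proj₁ (initial-wellOrder ∣ F ∣)
      open WellOrder W

      -- Strictness comes from the initial well-order: no segment below `x` admits an embedding of
      -- `F`.
      small : ∀ x D → ∣ ∁-image D (below x) ∣ ≺ ∣ F ∣
      small x D =
        value-≼ (below x) ↣-∘ ∁-image-≼ D (below x) ,
        λ F≼ → proj₂ (initial-wellOrder ∣ F ∣) x (∁-image-≼ D (below x) ↣-∘ F≼)

      Preimage : ∣ F ∣ → Pred (𝒫 ℕ) 0ℓ
      Preimage x C = ∃[ B ] B ∈ I × C ≡ B ∘ value x

      unreduced : ∀ x D → full ∉ K ⟨ ∁-image D (below x) ⟩ →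
                  ∃[ C ] C ∈ Preimage x × C ∉ K ⟨ ∁-image D (below x) ⟩
      -- If every preimage under `f` of a set in `I` were in the ideal, `f` itself would be a
      -- forbidden reduction.
      unreduced x D full∉ = byContra λ stuck →
        none _ (small x D) full∉ (value x , member x , λ B B∈I →
          byContra λ f⁻¹B∉ → stuck (B ∘ value x , (B , B∈I , refl) , f⁻¹B∉))

      open Recursion W K-ideal Preimage unreduced

    ≺𝔲⇒ultrafilter : ∣ F ∣ ≺ 𝔲 I F J G →
      Σ[ V ∈ Family ] IsUltrafilter V × ¬ (I ≤[ F ] V *) × J ≤[ G ] V *
    ≺𝔲⇒ultrafilter (_ , 𝔲⋠F) = byContra λ none →
      -- Without such an ultrafilter `∣ F ∣` is a candidate, so minimality embeds `𝔲` into it.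
      𝔲⋠F (IsLeast.lower 𝔲-isLeast ∣ F ∣
        (inj₁ (functions-≼-𝔠 F , λ J′ J′-ideal (g , g∈G , g⁻¹) → byContra λ noA →
          let (V , V-ultra , I≰ , J′⊆V*) = avoiding-ultrafilter J′-ideal
                λ A A≺F full∉ I≤ → noA (A , A≺F , full∉ , I≤)
          in none (V , V-ultra , I≰ , g , g∈G , λ B B∈J → J′⊆V* (g⁻¹ B B∈J)))))

theorem3p4 : (em : ∀ {ℓ} → ExcludedMiddle ℓ) (fe : ∀ {a b} → Extensionality a b) →
    let open Classical em fe in
    (I J : Family) → IsIdeal I → IsIdeal J →
    (F G : Pred (ℕ → ℕ) 0ℓ) → id ∈ G →
    (∣ F ∣ ≺ 𝔲 I F J G)
    ⇔
    (Σ[ U ∈ Family ] IsUltrafilter U × ¬ (I ≤[ F ] U *) × J ≤[ G ] U *)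
theorem3p4 em fe I J _ _ F G _ =
  mk⇔ ≺𝔲⇒ultrafilter λ (V , V-ultra , I≰ , J≤) → ultrafilter⇒≺𝔲 V-ultra I≰ J≤
  where open Consequences em fe
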